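{- $\mathbf{JID} \subseteq \mathbf{Dms}$; that is, every algebra in the variety $\mathbf{JID}$ satisfies the identity $(x \vee y)' \approx x' \wedge y'$.
   Context: A semi-Heyting algebra is an algebra $\langle L,\vee,\wedge,\to,0,1\rangle$ such that $\langle L,\vee,\wedge,0,1\rangle$ is a bounded lattice and the identities $x\wedge(x\to y)\approx x\wedge y$, $x\wedge(y\to z)\approx x\wedge[(x\wedge y)\to(x\wedge z)]$, $x\to x\approx 1$ hold. A $\mathbf{DQD}$-algebra (dually quasi-De Morgan semi-Heyting algebra) is an algebra $\langle L,\vee,\wedge,\to,{}',0,1\rangle$ whose reduct $\langle L,\vee,\wedge,\to,0,1\rangle$ is a semi-Heyting algebra and which satisfies: $0'\approx 1$ and $1'\approx 0$; $(x\wedge y)'\approx x'\vee y'$; $(x\vee y)''\approx x''\vee y''$; $x''\le x$. $\mathbf{DQD}$ denotes the variety of all $\mathbf{DQD}$-algebras. $\mathbf{JID}$ is the subvariety of $\mathbf{DQD}$ defined by the identity $x'\vee(y\to z)\approx(x'\vee y)\to(x'\vee z)$. $\mathbf{Dms}$ is the subvariety of $\mathbf{DQD}$ defined by the identity $(x\vee y)'\approx x'\wedge y'$. -}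

module Defs where

open import Algebra.Core using (Op₁; Op₂)
open import Algebra.Lattice.Bundles using (Lattice)
open import Level using (Level; suc; _⊔_)
open import Relation.Binary.Bundles using (Poset)
open import Relation.Binary.Core using (Rel)
open import Relation.Unary using (Pred)
import Algebra.Definitions as AlgebraDefinitions
import Algebra.Lattice.Properties.Lattice as LatticeProperties
import Algebra.Lattice.Structures as LatticeStructures

-- Algebras are taken over a setoid, as in the standard library: the
-- identities hold up to _≈_, and every basic operation respects _≈_.

record SemiHeytingAlgebra (c ℓ : Level) : Set (suc (c ⊔ ℓ)) where
  infix  4 _≈_
  infixr 5 _⇒_
  infixr 6 _∨_
  infixr 7 _∧_
  field
    Carrier : Set c
    _≈_     : Rel Carrier ℓ
    _∨_     : Op₂ Carrier
    _∧_     : Op₂ Carrier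
    _⇒_     : Op₂ Carrier
    0#      : Carrier
    1#      : Carrier

  open AlgebraDefinitions _≈_ using (Congruent₂; Identity)
  open LatticeStructures _≈_ using (IsLattice)

  field
    isLattice  : IsLattice _∨_ _∧_
    ∨-identity : Identity 0# _∨_
    ∧-identity : Identity 1# _∧_
    ⇒-cong     : Congruent₂ _⇒_
    ∧-⇒        : ∀ x y → x ∧ (x ⇒ y) ≈ x ∧ y
    ∧-⇒-∧      : ∀ x y z → x ∧ (y ⇒ z) ≈ x ∧ ((x ∧ y) ⇒ (x ∧ z))
    ⇒-refl     : ∀ x → (x ⇒ x) ≈ 1#

  lattice : Lattice c ℓ
  lattice = record { isLattice = isLattice }

  open Lattice lattice public
    hiding (Carrier; _≈_; _∨_; _∧_; isLattice)

  -- The library's order on an algebraic lattice: x ≤ y is x ≈ x ∧ y.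
  open Poset (LatticeProperties.poset lattice) public using (_≤_)

record DQDAlgebra (c ℓ : Level) : Set (suc (c ⊔ ℓ)) where
  field
    semiHeytingAlgebra : SemiHeytingAlgebra c ℓ

  open SemiHeytingAlgebra semiHeytingAlgebra public
  open AlgebraDefinitions _≈_ using (Congruent₁)

  infixl 8 _′
  field
    _′     : Op₁ Carrier
    ′-cong : Congruent₁ _′
    0′≈1   : 0# ′ ≈ 1#
    1′≈0   : 1# ′ ≈ 0#
    ∧-′    : ∀ x y → (x ∧ y) ′ ≈ x ′ ∨ y ′
    ∨-′′   : ∀ x y → (x ∨ y) ′ ′ ≈ x ′ ′ ∨ y ′ ′
    ′′-≤   : ∀ x → x ′ ′ ≤ x

-- A subvariety of DQD is given as the predicate on DQD-algebras saying
-- that its defining identity holds.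

JID : ∀ {c ℓ} → Pred (DQDAlgebra c ℓ) (c ⊔ ℓ)
JID L = ∀ x y z → x ′ ∨ (y ⇒ z) ≈ ((x ′ ∨ y) ⇒ (x ′ ∨ z))
  where open DQDAlgebra L

Dms : ∀ {c ℓ} → Pred (DQDAlgebra c ℓ) (c ⊔ ℓ)
Dms L = ∀ x y → (x ∨ y) ′ ≈ x ′ ∧ y ′
  where open DQDAlgebra L

{-# OPTIONS --safe #-}
module Submission where

-- Why the identity holds.  Call an element closed when x ≤ x ′ ′ (the other
-- inequality is an axiom).  Three facts give the result.
--
--  * In a DQD-algebra every complemented element is closed
--    (complement⇒closed).  If a ∨ b ≈ 1, then applying ′ ′, which preserves
--    joins and 1, gives a ′ ′ ∨ b ′ ′ ≈ 1, hence a ∨ b ′ ′ ≈ 1; if also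
--    a ∧ b ≈ 0, then distributivity yields b ≤ b ′ ′.
--  * In a JID-algebra every x ′ is complemented, by x ′ ⇒ 0
--    (′-complemented): the defining identity with y = x ′ and z = 0 reads
--    x ′ ∨ (x ′ ⇒ 0) ≈ (x ′ ⇒ x ′) ≈ 1.
--  * Complemented elements of a bounded distributive lattice are closed
--    under meets (∧-complement).
--
-- Hence x ′ ∧ y ′ is closed, and
--   x ′ ∧ y ′ ≤ (x ′ ∧ y ′) ′ ′ ≈ (x ′ ′ ∨ y ′ ′) ′ ≈ (x ∨ y) ′ ′ ′ ≤ (x ∨ y) ′.
-- The reverse inequality holds because ′ is antitone.

open import Defs
open import Data.Product.Base using (_×_; _,_; proj₁; proj₂)
open import Relation.Binary.Lattice.Bundles as OrderTheoretic using (HeytingAlgebra)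
open import Relation.Unary using (_∈_)
import Algebra.Lattice.Properties.Lattice as LatticeProperties
import Relation.Binary.Lattice.Properties.HeytingAlgebra as HeytingProperties
import Relation.Binary.Lattice.Properties.JoinSemilattice as JoinProperties
import Relation.Binary.Lattice.Properties.MeetSemilattice as MeetProperties
import Relation.Binary.Reasoning.PartialOrder as PosetReasoning

module SemiHeyting {c ℓ} (S : SemiHeytingAlgebra c ℓ) where
  open SemiHeytingAlgebra S
  open LatticeProperties lattice public
    using (poset; ∨-idem; ∨-∧-isOrderTheoreticLattice; ∨-∧-orderTheoreticLattice)
  open OrderTheoretic.Lattice ∨-∧-orderTheoreticLattice public
    using ( antisym; x≤x∨y; y≤x∨y; ∨-least; x∧y≤x; x∧y≤y; ∧-greatest
          ; joinSemilattice; meetSemilattice )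
    renaming (refl to ≤-refl; reflexive to ≤-reflexive; trans to ≤-trans)
  open JoinProperties joinSemilattice public using (∨-monotonic)
  open MeetProperties meetSemilattice public using (∧-monotonic)
  open PosetReasoning poset

  -- The Heyting algebra on the same lattice, with x ⇨ y = x ⇒ x ∧ y.  The
  -- operation ⇒ itself need not be residual to ∧.  The residuation law gives
  -- distributivity of the lattice.
  heytingAlgebra : HeytingAlgebra c ℓ ℓ
  heytingAlgebra = record
    { _⇨_ = λ x y → x ⇒ x ∧ y
    ; ⊤ = 1#
    ; ⊥ = 0#
    ; isHeytingAlgebra = record
      { isBoundedLattice = record
        { isLattice = ∨-∧-isOrderTheoreticLattice
        ; maximum = λ x → sym (proj₂ ∧-identity x)
        ; minimum = λ x → trans (sym (∧-absorbs-∨ 0# x))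
                                (∧-congˡ (proj₁ ∨-identity x))
        }
      ; exponential = λ w x y → curry w x y , uncurry w x y
      }
    }
    where
    -- Relative to w, the implication x ⇒ x ∧ y becomes
    -- w ∧ x ⇒ w ∧ x, which is 1.
    curry : ∀ w x y → w ∧ x ≤ y → w ≤ (x ⇒ x ∧ y)
    curry w x y w∧x≤y = sym (begin-equality
      w ∧ (x ⇒ x ∧ y)            ≈⟨ ∧-⇒-∧ w x (x ∧ y) ⟩
      w ∧ (w ∧ x ⇒ w ∧ (x ∧ y))  ≈⟨ ∧-congˡ (⇒-cong refl (∧-assoc w x y)) ⟨
      w ∧ (w ∧ x ⇒ (w ∧ x) ∧ y)  ≈⟨ ∧-congˡ (⇒-cong refl w∧x≤y) ⟨
      w ∧ (w ∧ x ⇒ w ∧ x)        ≈⟨ ∧-congˡ (⇒-refl (w ∧ x)) ⟩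
      w ∧ 1#                     ≈⟨ proj₂ ∧-identity w ⟩
      w                          ∎)

    uncurry : ∀ w x y → w ≤ (x ⇒ x ∧ y) → w ∧ x ≤ y
    uncurry w x y w≤x⇒x∧y = begin
      w ∧ x              ≤⟨ ∧-monotonic w≤x⇒x∧y ≤-refl ⟩
      (x ⇒ x ∧ y) ∧ x    ≈⟨ ∧-comm _ x ⟩
      x ∧ (x ⇒ x ∧ y)    ≈⟨ ∧-⇒ x (x ∧ y) ⟩
      x ∧ (x ∧ y)        ≤⟨ x∧y≤y x (x ∧ y) ⟩
      x ∧ y              ≤⟨ x∧y≤y x y ⟩
      y                  ∎

  open HeytingAlgebra heytingAlgebra public using (maximum; minimum)
  open HeytingProperties heytingAlgebra public using (∧-distribˡ-∨-≤)

  -- Complement a b says that b is a complement of a: a ∧ b ≈ 0# and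
  -- a ∨ b ≈ 1#, each given by its nontrivial inequality.
  Complement : Carrier → Carrier → Set ℓ
  Complement a b = (a ∧ b ≤ 0#) × (1# ≤ a ∨ b)

  complement-sym : ∀ {a b} → Complement a b → Complement b a
  complement-sym {a} {b} (a∧b≤0 , 1≤a∨b) =
    ≤-trans (≤-reflexive (∧-comm b a)) a∧b≤0 ,
    ≤-trans 1≤a∨b (≤-reflexive (∨-comm a b))

  -- If x and z join to 1 and y meets x below z, then y ≤ z.
  ≤-by-cases : ∀ {x y z} → 1# ≤ x ∨ z → y ∧ x ≤ z → y ≤ z
  ≤-by-cases {x} {y} {z} 1≤x∨z y∧x≤z = begin
    y              ≤⟨ ∧-greatest ≤-refl (≤-trans (maximum y) 1≤x∨z) ⟩
    y ∧ (x ∨ z)    ≤⟨ ∧-distribˡ-∨-≤ y x z ⟩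
    y ∧ x ∨ y ∧ z  ≤⟨ ∨-least y∧x≤z (x∧y≤y y z) ⟩
    z              ∎

  -- De Morgan's law for complements.
  ∧-complement : ∀ {a b a* b*} → Complement a a* → Complement b b* →
                 Complement (a ∧ b) (a* ∨ b*)
  ∧-complement {a} {b} {a*} {b*} (a∧a*≤0 , 1≤a∨a*) (b∧b*≤0 , 1≤b∨b*) =
    disjoint , ≤-by-cases covers-a (≤-trans (x∧y≤y 1# a) a≤join)
    where
    join : Carrier
    join = a ∧ b ∨ (a* ∨ b*)

    disjoint : (a ∧ b) ∧ (a* ∨ b*) ≤ 0#
    disjoint = begin
      (a ∧ b) ∧ (a* ∨ b*)          ≤⟨ ∧-distribˡ-∨-≤ (a ∧ b) a* b* ⟩
      (a ∧ b) ∧ a* ∨ (a ∧ b) ∧ b*  ≤⟨ ∨-least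
        (≤-trans (∧-monotonic (x∧y≤x a b) ≤-refl) a∧a*≤0)
        (≤-trans (∧-monotonic (x∧y≤y a b) ≤-refl) b∧b*≤0) ⟩
      0#                           ∎

    covers-a : 1# ≤ a ∨ join
    covers-a = ≤-trans 1≤a∨a* (∨-monotonic ≤-refl
      (≤-trans (x≤x∨y a* b*) (y≤x∨y (a ∧ b) _)))

    covers-b : 1# ≤ b ∨ join
    covers-b = ≤-trans 1≤b∨b* (∨-monotonic ≤-refl
      (≤-trans (y≤x∨y a* b*) (y≤x∨y (a ∧ b) _)))

    a≤join : a ≤ join
    a≤join = ≤-by-cases covers-b (x≤x∨y (a ∧ b) _)

module DQD {c ℓ} (L : DQDAlgebra c ℓ) where
  open DQDAlgebra L
  open SemiHeyting semiHeytingAlgebra public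
  open PosetReasoning poset

  ′-antitone : ∀ {x y} → x ≤ y → y ′ ≤ x ′
  ′-antitone {x} {y} x≤y = begin
    y ′        ≤⟨ y≤x∨y (x ′) (y ′) ⟩
    x ′ ∨ y ′  ≈⟨ ∧-′ x y ⟨
    (x ∧ y) ′  ≈⟨ ′-cong x≤y ⟨
    x ′        ∎

  1≤1′′ : 1# ≤ 1# ′ ′
  1≤1′′ = ≤-reflexive (sym (trans (′-cong 1′≈0) 0′≈1))

  complement⇒closed : ∀ {a b} → Complement a b → b ≤ b ′ ′
  complement⇒closed {a} {b} (a∧b≤0 , 1≤a∨b) = ≤-by-cases
    (begin
      1#             ≤⟨ 1≤1′′ ⟩
      1# ′ ′         ≤⟨ ′-antitone (′-antitone 1≤a∨b) ⟩
      (a ∨ b) ′ ′    ≈⟨ ∨-′′ a b ⟩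
      a ′ ′ ∨ b ′ ′  ≤⟨ ∨-monotonic (′′-≤ a) ≤-refl ⟩
      a ∨ b ′ ′      ∎)
    (begin
      b ∧ a          ≈⟨ ∧-comm b a ⟩
      a ∧ b          ≤⟨ a∧b≤0 ⟩
      0#             ≤⟨ minimum (b ′ ′) ⟩
      b ′ ′          ∎)

  ′-complemented : L ∈ JID → ∀ x → Complement (x ′) (x ′ ⇒ 0#)
  ′-complemented jid x =
    (begin
      x ′ ∧ (x ′ ⇒ 0#)           ≈⟨ ∧-⇒ (x ′) 0# ⟩
      x ′ ∧ 0#                   ≤⟨ x∧y≤y (x ′) 0# ⟩
      0#                         ∎) ,
    (begin
      1#                         ≈⟨ ⇒-refl (x ′) ⟨
      (x ′ ⇒ x ′)                ≈⟨ ⇒-cong (∨-idem (x ′)) (proj₂ ∨-identity (x ′)) ⟨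
      (x ′ ∨ x ′ ⇒ x ′ ∨ 0#)     ≈⟨ jid x (x ′) 0# ⟨
      x ′ ∨ (x ′ ⇒ 0#)           ∎)

theorem3p5 : ∀ {c ℓ} (L : DQDAlgebra c ℓ) → L ∈ JID → L ∈ Dms
theorem3p5 L jid x y = antisym
  (∧-greatest (′-antitone (x≤x∨y x y)) (′-antitone (y≤x∨y x y)))
  (begin
    x ′ ∧ y ′            ≤⟨ complement⇒closed (complement-sym
                              (∧-complement (′-complemented jid x) (′-complemented jid y))) ⟩
    (x ′ ∧ y ′) ′ ′      ≈⟨ ′-cong (∧-′ (x ′) (y ′)) ⟩
    (x ′ ′ ∨ y ′ ′) ′    ≈⟨ ′-cong (∨-′′ x y) ⟨
    (x ∨ y) ′ ′ ′        ≤⟨ ′′-≤ ((x ∨ y) ′) ⟩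
    (x ∨ y) ′            ∎)
  where
  open DQDAlgebra L
  open DQD L
  open PosetReasoning poset
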